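{- Let $k\geq 2$. The generating function of the maximal cube polynomials $H_{M_{n,k}}(x)$ of the Munarini graphs is $$\sum_{n\geq 0} H_{M_{n,k}}(x)\,t^n=\frac{1}{1-(k-1)xt-xt^2}$$ as formal power series in $t$ with coefficients in $\mathbb{Z}[x]$.
   Context: For integers $k\geq 1$, $n\geq 0$, a $k$-generalized Pell string of length $n$ is a word of length $n$ over the alphabet $\{0,1,\ldots,k\}$ in which every maximal run of the character $k$ has even length (equivalently, a concatenation of letters from $\{0,1,\ldots,k-1,kk\}$). Let $\mathcal{F}_{n,k}$ be the set of these strings (for $n=0$ it contains only the empty string). The Munarini graph $M_{n,k}$ is the simple graph with vertex set $\mathcal{F}_{n,k}$ in which two vertices are adjacent if one of them can be obtained from the other either by replacing one occurrence of $0$ with some $i\in\{1,\ldots,k-1\}$, or by replacing one substring $00$ (two consecutive positions) with $kk$ (both replacements may be read in either direction, and both strings must be in $\mathcal{F}_{n,k}$). A maximal hypercube of a graph $G$ is an induced subgraph of $G$ isomorphic to a hypercube $Q_p$ for some $p\geq 0$ ($Q_0=K_1$) that is not contained in a larger induced hypercube of $G$. Let $h_p(G)$ be the number of maximal hypercubes of dimension $p$ of $G$; the maximal cube polynomial is $H_G(x)=\sum_{p\geq 0}h_p(G)x^p$. -}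

module Defs where

open import Data.Bool.Base using (Bool; true; false)
import Data.Bool.Properties as Bool
open import Data.Empty using (⊥)
open import Data.Fin.Base as Fin using (Fin; zero; suc; fromℕ; fromℕ<; toℕ)
import Data.Fin.Properties as Fin
open import Data.Fin.Subset using (Subset; _∈_; _⊂_)
open import Data.Fin.Subset.Properties using (_∈?_; _⊂?_; anySubset?)
open import Data.Integer.Base as ℤ using (ℤ; +_; 0ℤ; 1ℤ)
open import Data.List.Base as List using (List; []; _∷_; _++_; replicate; head; last; length; filter; map; foldr; upTo; applyUpTo; allFin; cartesianProductWith)
open import Data.List.Membership.Propositional using () renaming (_∈_ to _∈ˡ_)
open import Data.List.Membership.Propositional.Properties using (∈-filter⁺; ∈-filter⁻; ∈-lookup; ∈-cartesianProductWith⁺; ∈-allFin)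
import Data.List.Properties as List using (∷-injectiveˡ)
open import Data.List.Properties using (filter-none)
import Data.List.Relation.Unary.All as All
open import Data.List.Relation.Unary.AllPairs using ([]; _∷_)
open import Data.List.Relation.Unary.Any as Any using (here; there)
open import Data.List.Relation.Unary.Any.Properties using (lookup-index)
open import Data.List.Relation.Unary.Unique.Propositional using (Unique)
import Data.List.Relation.Unary.Unique.Propositional.Properties as Unique
open import Data.Maybe.Base using (just)
open import Data.Maybe.Properties using (just-injective)
open import Data.Nat.Base as ℕ using (ℕ; zero; suc; _≤_; _∸_; s≤s; z≤n; NonZero)
open import Data.Nat.Divisibility using (_∣_; divides; _∣0; ∣-refl; ∣m∣n⇒∣m+n; ∣m+n∣m⇒∣n)
import Data.Nat.Properties as ℕ
open import Data.Product using (∃; ∃-syntax; ∃!; _×_; _,_; proj₁; proj₂)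
open import Data.Sum.Base using (_⊎_; inj₁; inj₂; swap)
open import Data.Vec.Base as Vec using (Vec; []; _∷_; lookup; tabulate; toList)
import Data.Vec.Properties as Vec
open import Data.Vec.Properties.WithK using ([]=-irrelevant)
open import Function.Base using (_∘_)
open import Function.Bundles using (_↔_; _⇔_; mk↔ₛ′; mk⇔; Inverse; Equivalence)
open import Relation.Binary.PropositionalEquality using (_≡_; _≢_; _≗_; refl; sym; trans; cong; subst; subst₂)
open import Relation.Nullary using (¬_; Dec; yes; no; does; contradiction)
open import Relation.Nullary.Decidable using (map′; _×-dec_; _⊎-dec_; _→-dec_; ¬?; recompute; dec-true; dec-false)

record Graph : Set₁ where
  field
    Vertex   : Set
    _~_      : Vertex → Vertex → Set
    ~-sym    : ∀ {u v} → u ~ v → v ~ u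
    ~-irrefl : ∀ {v} → ¬ (v ~ v)

record _≅_ (G H : Graph) : Set where
  private
    module G = Graph G
    module H = Graph H
  field
    bijection : G.Vertex ↔ H.Vertex
  open Inverse bijection public using (to; from)
  field
    adjacency : ∀ u v → (u G.~ v) ⇔ (to u H.~ to v)

record FinGraph : Set₁ where
  field
    graph : Graph
  open Graph graph public
  field
    _~?_  : ∀ u v → Dec (u ~ v)
    size  : ℕ
    enum  : Fin size ↔ Vertex

  vertex : Fin size → Vertex
  vertex = Inverse.to enum

  index : Vertex → Fin size
  index = Inverse.from enum

  index-vertex : ∀ i → index (vertex i) ≡ i
  index-vertex = Inverse.strictlyInverseʳ enum

  vertex-index : ∀ v → vertex (index v) ≡ v
  vertex-index = Inverse.strictlyInverseˡ enum

-- A set of vertices is a subset of the index set Fin size, so that an induced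
-- subgraph is the same thing as an element of Subset size.
induced : (G : FinGraph) → Subset (FinGraph.size G) → Graph
induced G S = record
  { Vertex   = ∃[ v ] (index v ∈ S)
  ; _~_      = λ u v → proj₁ u ~ proj₁ v
  ; ~-sym    = ~-sym
  ; ~-irrefl = ~-irrefl
  }
  where open FinGraph G

DifferOnce : ∀ {p} → Vec Bool p → Vec Bool p → Set
DifferOnce u v = ∃! _≡_ (λ i → lookup u i ≢ lookup v i)

Q : ℕ → Graph
Q p = record
  { Vertex   = Vec Bool p
  ; _~_      = DifferOnce
  ; ~-sym    = λ (i , d , unique) → i , d ∘ sym , λ e → unique (e ∘ sym)
  ; ~-irrefl = λ (_ , d , _) → d refl
  }

IsCube : (G : FinGraph) → ℕ → Subset (FinGraph.size G) → Set
IsCube G p S = Q p ≅ induced G S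

IsMaximalCube : (G : FinGraph) → ℕ → Subset (FinGraph.size G) → Set
IsMaximalCube G p S = IsCube G p S × ¬ (∃[ q ] ∃[ T ] (IsCube G q T × S ⊂ T))

differOnce? : ∀ {p} (u v : Vec Bool p) → Dec (DifferOnce u v)
differOnce? u v = map′
  (λ (i , d , unique) → i , d , λ {j} → unique j)
  (λ (i , d , unique) → i , d , λ j → unique {j})
  (Fin.any? λ i → differ? i ×-dec Fin.all? λ j → differ? j →-dec (i Fin.≟ j))
  where
  differ? : ∀ i → Dec (lookup u i ≢ lookup v i)
  differ? i = ¬? (lookup u i Bool.≟ lookup v i)

allBits? : ∀ {p} {P : Vec Bool p → Set} → (∀ u → Dec (P u)) → Dec (∀ u → P u)
allBits? {zero}  P? = map′ (λ { x [] → x }) (λ f → f []) (P? [])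
allBits? {suc p} P? = map′
  (λ { (f , g) (false ∷ u) → f u ; (f , g) (true ∷ u) → g u })
  (λ f → (f ∘ (false ∷_)) , (f ∘ (true ∷_)))
  (allBits? (P? ∘ (false ∷_)) ×-dec allBits? (P? ∘ (true ∷_)))

anyBits? : ∀ {p} {P : Vec Bool p → Set} → (∀ u → Dec (P u)) → Dec (∃ P)
anyBits? = anySubset?

join : ∀ {p} {A : Set} → (Vec Bool p → A) → (Vec Bool p → A) → Vec Bool (suc p) → A
join f g (false ∷ u) = f u
join f g (true  ∷ u) = g u

anyMap? : ∀ {p m} {P : (Vec Bool p → Fin m) → Set} →
          (∀ {f g} → f ≗ g → P f → P g) → (∀ f → Dec (P f)) → Dec (∃ P)
anyMap? {zero} resp P? = map′
  (λ (i , x) → (λ _ → i) , x)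
  (λ (f , x) → f [] , resp (λ { [] → refl }) x)
  (Fin.any? λ i → P? (λ _ → i))
anyMap? {suc p} {m} {P} resp P? = map′
  (λ (f , g , x) → join f g , x)
  (λ (f , x) → f ∘ (false ∷_) , f ∘ (true ∷_) ,
     resp (λ { (false ∷ u) → refl ; (true ∷ u) → refl }) x)
  (anyMap?
    (λ e (g , x) → g , resp (λ { (false ∷ u) → e u ; (true ∷ u) → refl }) x)
    (λ f → anyMap?
      (λ e → resp (λ { (false ∷ u) → refl ; (true ∷ u) → e u }))
      (λ g → P? (join f g))))

module _ (G : FinGraph) where
  open FinGraph G

  record IsCubeMap (p : ℕ) (S : Subset size) (f : Vec Bool p → Fin size) : Set where
    constructor cubeMap
    field
      lands : ∀ u → f u ∈ S
      onto  : ∀ i → i ∈ S → ∃[ u ] (f u ≡ i)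
      inj   : ∀ u v → f u ≡ f v → u ≡ v
      adj   : ∀ u v → (DifferOnce u v → vertex (f u) ~ vertex (f v))
                    × (vertex (f u) ~ vertex (f v) → DifferOnce u v)

  isCubeMap? : ∀ p S f → Dec (IsCubeMap p S f)
  isCubeMap? p S f = map′
    (λ (a , b , c , d) → cubeMap a b c d)
    (λ (cubeMap a b c d) → a , b , c , d)
    (allBits? (λ u → f u ∈? S)
      ×-dec Fin.all? (λ i → (i ∈? S) →-dec anyBits? (λ u → f u Fin.≟ i))
      ×-dec allBits? (λ u → allBits? λ v →
              (f u Fin.≟ f v) →-dec Vec.≡-dec Bool._≟_ u v)
      ×-dec allBits? (λ u → allBits? λ v →
              (differOnce? u v →-dec (vertex (f u) ~? vertex (f v)))
              ×-dec ((vertex (f u) ~? vertex (f v)) →-dec differOnce? u v)))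

  isCubeMap-resp : ∀ {p S f g} → f ≗ g → IsCubeMap p S f → IsCubeMap p S g
  isCubeMap-resp {p} {S} {f} {g} e (cubeMap a b c d) = cubeMap
    (λ u → subst (_∈ S) (e u) (a u))
    (λ i i∈S → let (u , q) = b i i∈S in u , trans (sym (e u)) q)
    (λ u v q → c u v (trans (e u) (trans q (sym (e v)))))
    (λ u v → (λ x → subst₂ (λ i j → vertex i ~ vertex j) (e u) (e v) (proj₁ (d u v) x))
           , (λ x → proj₂ (d u v) (subst₂ (λ i j → vertex i ~ vertex j) (sym (e u)) (sym (e v)) x)))

  induced-≡ : ∀ {S} {x y : Graph.Vertex (induced G S)} → proj₁ x ≡ proj₁ y → x ≡ y
  induced-≡ {x = v , a} {y = _ , b} refl = cong (v ,_) ([]=-irrelevant a b)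

  cubeMap⇒isCube : ∀ {p S} → ∃ (IsCubeMap p S) → IsCube G p S
  cubeMap⇒isCube {p} {S} (f , cubeMap a b c d) = record
    { bijection = mk↔ₛ′ to from to-from
        (λ u → c _ _ (trans (proj₂ (pre (to u))) (index-vertex (f u))))
    ; adjacency = λ u v → mk⇔ (proj₁ (d u v)) (proj₂ (d u v))
    }
    where
    to : Vec Bool p → Graph.Vertex (induced G S)
    to u = vertex (f u) , subst (_∈ S) (sym (index-vertex (f u))) (a u)
    pre : (x : Graph.Vertex (induced G S)) → ∃[ u ] (f u ≡ index (proj₁ x))
    pre (v , v∈S) = b (index v) v∈S
    from : Graph.Vertex (induced G S) → Vec Bool p
    from = proj₁ ∘ pre
    to-from : ∀ x → to (from x) ≡ x
    to-from x = induced-≡ (trans (cong vertex (proj₂ (pre x))) (vertex-index (proj₁ x)))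

  isCube⇒cubeMap : ∀ {p S} → IsCube G p S → ∃ (IsCubeMap p S)
  isCube⇒cubeMap {p} {S} iso = f , cubeMap
    (λ u → proj₂ (to u))
    (λ i i∈S → let x = (vertex i , subst (_∈ S) (sym (index-vertex i)) i∈S) in
       from x , trans (cong (index ∘ proj₁) (Inverse.strictlyInverseˡ bijection x)) (index-vertex i))
    (λ u v q → to-inj (induced-≡ (index-inj q)))
    (λ u v → (λ x → subst₂ _~_ (sym (vertex-index _)) (sym (vertex-index _))
                      (Equivalence.to (adjacency u v) x))
           , (λ x → Equivalence.from (adjacency u v)
                      (subst₂ _~_ (vertex-index _) (vertex-index _) x)))
    where
    open _≅_ iso
    f : Vec Bool p → Fin size
    f = index ∘ proj₁ ∘ to
    index-inj : ∀ {u v} → index u ≡ index v → u ≡ v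
    index-inj q = trans (sym (vertex-index _)) (trans (cong vertex q) (vertex-index _))
    to-inj : ∀ {u v} → to u ≡ to v → u ≡ v
    to-inj {u} {v} q = trans (sym (Inverse.strictlyInverseʳ bijection u))
                         (trans (cong from q) (Inverse.strictlyInverseʳ bijection v))

  isCube? : ∀ p S → Dec (IsCube G p S)
  isCube? p S = map′ cubeMap⇒isCube isCube⇒cubeMap
    (anyMap? isCubeMap-resp (isCubeMap? p S))

  isCube⇒≤size : ∀ {p S} → IsCube G p S → p ≤ size
  isCube⇒≤size {p} iso = Fin.injective⇒≤ {f = f ∘ unit} (λ q → unit-inj _ _ (inj _ _ q))
    where
    f = proj₁ (isCube⇒cubeMap iso)
    open IsCubeMap (proj₂ (isCube⇒cubeMap iso))
    unit : Fin p → Vec Bool p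
    unit i = tabulate (λ j → does (i Fin.≟ j))
    unit-inj : ∀ i j → unit i ≡ unit j → i ≡ j
    unit-inj i j q with i Fin.≟ j
    ... | yes e = e
    ... | no ¬e = contradiction (trans (sym at-i) (trans (cong (λ w → lookup w j) q) at-j)) λ ()
      where
      at-i : lookup (unit i) j ≡ false
      at-i = trans (Vec.lookup∘tabulate _ j) (dec-false (i Fin.≟ j) ¬e)
      at-j : lookup (unit j) j ≡ true
      at-j = trans (Vec.lookup∘tabulate _ j) (dec-true (j Fin.≟ j) refl)

  isMaximalCube? : ∀ p S → Dec (IsMaximalCube G p S)
  isMaximalCube? p S = isCube? p S ×-dec ¬? (map′
    (λ (q , x) → toℕ q , x)
    (λ (q , T , c , l) → let q< = s≤s (isCube⇒≤size c) in
       fromℕ< q< , T , subst (λ m → IsCube G m T) (sym (Fin.toℕ-fromℕ< q<)) c , l)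
    (Fin.any? {n = suc size} λ q → anySubset? λ T → isCube? (toℕ q) T ×-dec (S ⊂? T)))

allVecs : {A : Set} → List A → (n : ℕ) → List (Vec A n)
allVecs xs zero    = [] ∷ []
allVecs xs (suc n) = cartesianProductWith _∷_ xs (allVecs xs n)

allVecs-complete : ∀ {A : Set} {xs : List A} → (∀ a → a ∈ˡ xs) →
                   ∀ {n} (v : Vec A n) → v ∈ˡ allVecs xs n
allVecs-complete c []      = here refl
allVecs-complete c (a ∷ v) = ∈-cartesianProductWith⁺ _∷_ (c a) (allVecs-complete c v)

allVecs-unique : ∀ {A : Set} {xs : List A} → Unique xs → ∀ n → Unique (allVecs xs n)
allVecs-unique u zero    = All.[] ∷ []
allVecs-unique u (suc n) = Unique.cartesianProductWith⁺ _∷_ Vec.∷-injective u (allVecs-unique u n)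

allSubsets : (n : ℕ) → List (Subset n)
allSubsets = allVecs (false ∷ true ∷ [])

allSubsets-complete : ∀ {n} (S : Subset n) → S ∈ˡ allSubsets n
allSubsets-complete = allVecs-complete λ { false → here refl ; true → there (here refl) }

allSubsets-unique : ∀ n → Unique (allSubsets n)
allSubsets-unique = allVecs-unique (((λ ()) All.∷ All.[]) ∷ All.[] ∷ [])

-- Polynomials ℤ[x]: lists of coefficients, constant term first, compared
-- coefficientwise (so trailing zeros are immaterial).
Poly : Set
Poly = List ℤ

coeff : Poly → ℕ → ℤ
coeff []      _       = 0ℤ
coeff (a ∷ _) zero    = a
coeff (_ ∷ f) (suc i) = coeff f i

infix 4 _≈ₚ_
_≈ₚ_ : Poly → Poly → Set
f ≈ₚ g = ∀ i → coeff f i ≡ coeff g i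

0ₚ 1ₚ : Poly
0ₚ = []
1ₚ = 1ℤ ∷ []

infixl 6 _+ₚ_
_+ₚ_ : Poly → Poly → Poly
[]      +ₚ g       = g
(a ∷ f) +ₚ []      = a ∷ f
(a ∷ f) +ₚ (b ∷ g) = (a ℤ.+ b) ∷ (f +ₚ g)

-ₚ_ : Poly → Poly
-ₚ_ = map (ℤ.-_)

infixl 7 _*ₚ_
_*ₚ_ : Poly → Poly → Poly
[]      *ₚ g = []
(a ∷ f) *ₚ g = map (a ℤ.*_) g +ₚ (0ℤ ∷ (f *ₚ g))

infix 9 _·x
_·x : ℤ → Poly
a ·x = 0ℤ ∷ a ∷ []

Series : Set
Series = ℕ → Poly

infix 4 _≈ₛ_
_≈ₛ_ : Series → Series → Set
A ≈ₛ B = ∀ n → A n ≈ₚ B n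

infix 8 _·t^_
_·t^_ : Poly → ℕ → Series
(f ·t^ zero)  zero    = f
(f ·t^ zero)  (suc n) = 0ₚ
(f ·t^ suc m) zero    = 0ₚ
(f ·t^ suc m) (suc n) = (f ·t^ m) n

1ₛ : Series
1ₛ = 1ₚ ·t^ 0

infixl 6 _-ₛ_
_-ₛ_ : Series → Series → Series
(A -ₛ B) n = A n +ₚ (-ₚ B n)

infixl 7 _*ₛ_
_*ₛ_ : Series → Series → Series
(A *ₛ B) n = foldr _+ₚ_ 0ₚ (map (λ i → A i *ₚ B (n ∸ i)) (upTo (suc n)))

-- 1/D denotes the inverse of D in ℤ[x][[t]].
infix 4 _≈1/_
_≈1/_ : Series → Series → Set
A ≈1/ D = A *ₛ D ≈ₛ 1ₛ

h : FinGraph → ℕ → ℕ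
h G p = length (filter (isMaximalCube? G p) (allSubsets (FinGraph.size G)))

H : FinGraph → Poly
H G = applyUpTo (λ p → + h G p) (suc (FinGraph.size G))

-- Truncating at p ≤ size loses nothing: every coefficient of H G is h_p(G).
coeff-H : ∀ G p → coeff (H G) p ≡ + h G p
coeff-H G p = coeff-applyUpTo (λ p → + h G p) (suc size) p
    (λ size<p → cong (+_ ∘ length) (filter-none (isMaximalCube? G p) {allSubsets size}
      (All.tabulate λ {S} _ (c , _) → ℕ.<⇒≱ size<p (isCube⇒≤size G {S = S} c))))
  where
  open FinGraph G
  coeff-applyUpTo : ∀ (a : ℕ → ℤ) m p → (m ≤ p → a p ≡ 0ℤ) → coeff (applyUpTo a m) p ≡ a p
  coeff-applyUpTo a zero    p       z = sym (z z≤n)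
  coeff-applyUpTo a (suc m) zero    z = refl
  coeff-applyUpTo a (suc m) (suc p) z = coeff-applyUpTo (a ∘ suc) m p (z ∘ s≤s)

Word : ℕ → ℕ → Set
Word k n = Vec (Fin (suc k)) n

top : ∀ {k} → Fin (suc k)
top {k} = fromℕ k

-- The side conditions make the run of m letters k maximal (or m = 0, which is
-- even anyway).
RunsEven : ∀ {k} → List (Fin (suc k)) → Set
RunsEven w = ∀ xs m ys → w ≡ xs ++ replicate m top ++ ys →
             last xs ≢ just top → head ys ≢ just top → 2 ∣ m

IsPell : ∀ {k n} → Word k n → Set
IsPell w = RunsEven (toList w)

-- The description as a concatenation of letters 0, …, k-1 and blocks kk.
data Blocks {k : ℕ} : List (Fin (suc k)) → Set where
  []    : Blocks []
  _∷_   : ∀ {a w} → a ≢ top → Blocks w → Blocks (a ∷ w)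
  kk∷_  : ∀ {w} → Blocks w → Blocks (top ∷ top ∷ w)

private
  last-∷ : ∀ {A : Set} {a b : A} xs → a ≢ b → last xs ≢ just b → last (a ∷ xs) ≢ just b
  last-∷ []       a≢b _ = a≢b ∘ just-injective
  last-∷ (x ∷ xs) _   l = l

  last-∷⁻ : ∀ {A : Set} {a b : A} xs → last (a ∷ xs) ≢ just b → last xs ≢ just b
  last-∷⁻ []       _ = λ ()
  last-∷⁻ (x ∷ xs) l = l

  2∤1 : ¬ (2 ∣ 1)
  2∤1 (divides zero ())
  2∤1 (divides (suc _) ())

runs⇒blocks : ∀ {k} (w : List (Fin (suc k))) → RunsEven w → Blocks w
runs⇒blocks [] r = []
runs⇒blocks (a ∷ w) r with a Fin.≟ top
runs⇒blocks (a ∷ w) r | no a≢k = a≢k ∷ runs⇒blocks w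
  (λ xs m ys e l → r (a ∷ xs) m ys (cong (a ∷_) e) (last-∷ xs a≢k l))
runs⇒blocks (a ∷ []) r | yes refl =
  contradiction (r [] 1 [] refl (λ ()) (λ ())) 2∤1
runs⇒blocks (a ∷ b ∷ w) r | yes refl with b Fin.≟ top
... | no b≢k = contradiction (r [] 1 (b ∷ w) refl (λ ()) (b≢k ∘ just-injective)) 2∤1
... | yes refl = kk∷ runs⇒blocks w λ
  { [] m ys e l h → ∣m+n∣m⇒∣n (r [] (2 ℕ.+ m) ys (cong (λ v → top ∷ top ∷ v) e) l h) ∣-refl
  ; (x ∷ xs) m ys e l h → r (top ∷ top ∷ x ∷ xs) m ys (cong (λ v → top ∷ top ∷ v) e) l h
  }

blocks⇒runs : ∀ {k} {w : List (Fin (suc k))} → Blocks w → RunsEven w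
blocks⇒runs [] [] zero ys e l h = 2 ∣0
blocks⇒runs (a≢k ∷ b) [] zero ys e l h = 2 ∣0
blocks⇒runs (a≢k ∷ b) [] (suc m) ys refl l h = contradiction refl a≢k
blocks⇒runs (a≢k ∷ b) (x ∷ xs) m ys refl l h = blocks⇒runs b xs m ys refl (last-∷⁻ xs l) h
blocks⇒runs (kk∷ b) [] zero ys e l h = 2 ∣0
blocks⇒runs (kk∷ b) [] (suc zero) ys refl l h = contradiction refl h
blocks⇒runs (kk∷ b) [] (suc (suc m)) ys refl l h =
  ∣m∣n⇒∣m+n ∣-refl (blocks⇒runs b [] m ys refl (λ ()) h)
blocks⇒runs (kk∷ b) (x ∷ []) m ys e l h = contradiction (cong just (sym (List.∷-injectiveˡ e))) l
blocks⇒runs (kk∷ b) (x ∷ y ∷ xs) m ys refl l h =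
  blocks⇒runs b xs m ys refl (last-∷⁻ {a = y} xs l) h

blocks? : ∀ {k} (w : List (Fin (suc k))) → Dec (Blocks w)
blocks? [] = yes []
blocks? (a ∷ w) with a Fin.≟ top
blocks? (a ∷ w) | no a≢k = map′ (a≢k ∷_) (λ { (_ ∷ b) → b ; (kk∷ _) → contradiction refl a≢k }) (blocks? w)
blocks? (a ∷ []) | yes refl = no λ { (a≢k ∷ _) → a≢k refl }
blocks? (a ∷ b ∷ w) | yes refl with b Fin.≟ top
... | no b≢k = no λ { (a≢k ∷ _) → a≢k refl ; (kk∷ _) → b≢k refl }
... | yes refl = map′ kk∷_ (λ { (a≢k ∷ _) → contradiction refl a≢k ; (kk∷ b) → b }) (blocks? w)

isPell? : ∀ {k n} (w : Word k n) → Dec (IsPell w)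
isPell? w = map′ blocks⇒runs (runs⇒blocks (toList w)) (blocks? (toList w))

-- The proof field is irrelevant, so equality of strings is equality of words.
record PellString (n k : ℕ) : Set where
  constructor pellString
  field
    word    : Word k n
    .isPell : IsPell word

open PellString public

pellWords : (n k : ℕ) → List (Word k n)
pellWords n k = filter isPell? (allVecs (allFin (suc k)) n)

pellWords-unique : ∀ n k → Unique (pellWords n k)
pellWords-unique n k = Unique.filter⁺ isPell? (allVecs-unique (Unique.allFin⁺ (suc k)) n)

pellWords-complete : ∀ {n k} (s : PellString n k) → word s ∈ˡ pellWords n k
pellWords-complete (pellString w p) =
  ∈-filter⁺ isPell? (allVecs-complete ∈-allFin w) (recompute (isPell? w) p)

lookup-injective : ∀ {A : Set} {xs : List A} → Unique xs → ∀ i j →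
                   List.lookup xs i ≡ List.lookup xs j → i ≡ j
lookup-injective (_ ∷ _) zero    zero    _ = refl
lookup-injective (d ∷ _) zero    (suc j) e = contradiction e (All.lookup d (∈-lookup j))
lookup-injective (d ∷ _) (suc i) zero    e = contradiction (sym e) (All.lookup d (∈-lookup i))
lookup-injective (_ ∷ u) (suc i) (suc j) e = cong suc (lookup-injective u i j e)

word-injective : ∀ {n k} {s t : PellString n k} → word s ≡ word t → s ≡ t
word-injective refl = refl

pellEnum : ∀ n k → Fin (length (pellWords n k)) ↔ PellString n k
pellEnum n k = mk↔ₛ′ to from
  (λ s → word-injective (sym (lookup-index (pellWords-complete s))))
  (λ i → lookup-injective (pellWords-unique n k) _ _ (sym (lookup-index (pellWords-complete (to i)))))
  where
  to : Fin (length (pellWords n k)) → PellString n k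
  to i = pellString (List.lookup (pellWords n k) i)
    (proj₂ (∈-filter⁻ isPell? {xs = allVecs (allFin (suc k)) n} (∈-lookup i)))
  from : PellString n k → Fin (length (pellWords n k))
  from s = Any.index (pellWords-complete s)

infix 4 _⟶_
data _⟶_ {k : ℕ} : ∀ {n} → Word k n → Word k n → Set where
  letter : ∀ {n i} {w : Word k n} → i ≢ zero → i ≢ top → zero ∷ w ⟶ i ∷ w
  block  : ∀ {n} {w : Word k n} → zero ∷ zero ∷ w ⟶ top ∷ top ∷ w
  there  : ∀ {n a} {w w′ : Word k n} → w ⟶ w′ → a ∷ w ⟶ a ∷ w′

_⟶?_ : ∀ {k n} (w w′ : Word k n) → Dec (w ⟶ w′)
[] ⟶? [] = no λ ()
_⟶?_ {k} (a ∷ w) (b ∷ w′) = map′ build split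
  (letter? ⊎-dec block? a b w w′ ⊎-dec ((a Fin.≟ b) ×-dec (w ⟶? w′)))
  where
  IsLetter : Set
  IsLetter = a ≡ zero × b ≢ zero × b ≢ top × w ≡ w′

  letter? : Dec IsLetter
  letter? = (a Fin.≟ zero) ×-dec ¬? (b Fin.≟ zero) ×-dec ¬? (b Fin.≟ top)
            ×-dec Vec.≡-dec Fin._≟_ w w′

  IsBlock : ∀ {n} (a b : Fin (suc k)) (w w′ : Word k n) → Set
  IsBlock a b []      []       = ⊥
  IsBlock a b (c ∷ w) (d ∷ w′) = a ≡ zero × c ≡ zero × b ≡ top × d ≡ top × w ≡ w′

  block? : ∀ {n} (a b : Fin (suc k)) (w w′ : Word k n) → Dec (IsBlock a b w w′)
  block? a b []      []       = no λ ()
  block? a b (c ∷ w) (d ∷ w′) = (a Fin.≟ zero) ×-dec (c Fin.≟ zero) ×-dec (b Fin.≟ top)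
    ×-dec (d Fin.≟ top) ×-dec Vec.≡-dec Fin._≟_ w w′

  buildBlock : ∀ {n} {a b : Fin (suc k)} (w w′ : Word k n) → IsBlock a b w w′ → a ∷ w ⟶ b ∷ w′
  buildBlock []      []       ()
  buildBlock (c ∷ w) (d ∷ w′) (refl , refl , refl , refl , refl) = block

  build : IsLetter ⊎ IsBlock a b w w′ ⊎ (a ≡ b × w ⟶ w′) → a ∷ w ⟶ b ∷ w′
  build (inj₁ (refl , b≢0 , b≢k , refl)) = letter b≢0 b≢k
  build (inj₂ (inj₁ x))                  = buildBlock w w′ x
  build (inj₂ (inj₂ (refl , s)))         = there s

  split : a ∷ w ⟶ b ∷ w′ → IsLetter ⊎ IsBlock a b w w′ ⊎ (a ≡ b × w ⟶ w′)
  split (letter b≢0 b≢k) = inj₁ (refl , b≢0 , b≢k , refl)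
  split block            = inj₂ (inj₁ (refl , refl , refl , refl , refl))
  split (there s)        = inj₂ (inj₂ (refl , s))

⟶-irrefl : ∀ {k} .{{_ : NonZero k}} {n} {w w′ : Word k n} → w ⟶ w′ → w ≢ w′
⟶-irrefl         (letter i≢0 _) e = i≢0 (sym (Vec.∷-injectiveˡ e))
⟶-irrefl {suc k} block          e with () ← Vec.∷-injectiveˡ e
⟶-irrefl         (there s)      e = ⟶-irrefl s (Vec.∷-injectiveʳ e)

M : (n k : ℕ) → .{{NonZero k}} → FinGraph
M n k = record
  { graph = record
    { Vertex   = PellString n k
    ; _~_      = λ s t → word s ⟶ word t ⊎ word t ⟶ word s
    ; ~-sym    = swap
    ; ~-irrefl = λ { (inj₁ s) → ⟶-irrefl s refl ; (inj₂ s) → ⟶-irrefl s refl }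
    }
  ; _~?_  = λ s t → (word s ⟶? word t) ⊎-dec (word t ⟶? word s)
  ; size  = length (pellWords n k)
  ; enum  = pellEnum n k
  }

{-# OPTIONS --safe #-}

-- A Pell string is a set of disjoint tiles: a letter 1, …, k-1 covers one
-- position, a block kk two, and zeros are uncovered.  A step of ⟶ adds a tile.
-- In a 4-cycle opposite edges have the same orientation, since two distinct
-- words have at most one common upper neighbour.  Hence every induced cube has
-- a top vertex, and it lies in the cube of all sub-tilings of any tiling of
-- the whole word that extends the top vertex (one exists since k ≥ 2).  So the
-- maximal cubes are the cubes of full tilings, with the number of tiles as
-- dimension, and removing the first tile gives the recurrence
-- h(n+2,p+1) = (k-1) h(n+1,p) + h(n,p).

module Submission where

open import Defs
open import Data.Bool.Base using (Bool; true; false)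
import Data.Bool.Properties as Bool
open import Data.Fin.Base using (Fin; zero; suc; inject₁; lower₁; toℕ; combine; quotient; remainder)
import Data.Fin.Properties as Fin
open import Data.Fin.Subset using (Subset; _∈_; _⊆_; _⊂_)
open import Data.Fin.Subset.Properties using (_∈?_; ⊆-antisym)
open import Data.Integer.Base as ℤ using (+_; 0ℤ; 1ℤ; -1ℤ; _-_)
import Data.Integer.Properties as ℤ
open import Data.Integer.Solver using (module +-*-Solver)
open import Data.List.Base as List using (List; []; _∷_; _++_; length; filter; foldr; applyUpTo; allFin; cartesianProductWith)
open import Data.List.Membership.Propositional using () renaming (_∈_ to _∈ˡ_)
open import Data.List.Membership.Propositional.Properties using (∈-filter⁺; ∈-filter⁻; ∈-map⁺; ∈-map⁻; ∈-++⁺ˡ; ∈-++⁺ʳ; ∈-cartesianProductWith⁺; ∈-cartesianProductWith⁻; ∈-allFin)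
open import Data.List.Membership.Propositional.Properties.WithK using (unique∧set⇒bag)
open import Data.List.Properties using (length-++; length-map; length-tabulate; map-upTo)
open import Data.List.Relation.Binary.BagAndSetEquality using (∼bag⇒↭)
open import Data.List.Relation.Binary.Disjoint.Propositional using (Disjoint)
open import Data.List.Relation.Binary.Permutation.Propositional.Properties using (↭-length)
import Data.List.Relation.Unary.All as All
open import Data.List.Relation.Unary.AllPairs using ([]; _∷_)
open import Data.List.Relation.Unary.Any using (here)
open import Data.List.Relation.Unary.Unique.Propositional using (Unique)
import Data.List.Relation.Unary.Unique.Propositional.Properties as Unique
open import Data.Nat.Base using (ℕ; zero; suc; _+_; _*_; _^_; _∸_; _≤_; _<_; s≤s; z≤n; >-nonZero)
open import Data.Nat.Properties using (<⇒≤; ≮⇒≥; ≤-refl; ≤-antisym; m<n⇒m<1+n; m≤n⇒∃[o]m+o≡n; n∸n≡0; m+n∸n≡m; +-comm; +-suc; +-cancelʳ-≡; ^-monoʳ-<)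
open import Data.Product using (∃; ∃-syntax; _×_; _,_; proj₁; proj₂)
open import Data.Sum.Base as Sum using (_⊎_; inj₁; inj₂)
open import Data.Vec.Base using (Vec; []; _∷_; lookup; replicate; tabulate; toList)
import Data.Vec.Properties as Vec
open import Function.Base using (_∘_; _on_)
open import Function.Bundles using (Injection; Inverse; _↔_; mk⇔)
open import Function.Properties.Inverse using (↔-sym; ↔⇒↣)
open import Relation.Binary.Construct.Closure.ReflexiveTransitive using (Star; ε; _◅_; gmap)
open import Relation.Binary.PropositionalEquality using (_≡_; _≢_; refl; sym; trans; cong; cong₂; subst; subst₂)
open import Relation.Nullary using (¬_; Dec; yes; no; does; contradiction)
open import Relation.Nullary.Decidable using (decidable-stable; recompute; dec-true)
open +-*-Solver using (solve; con; _:+_; _:*_; :-_; _:=_)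

private variable
  m n p q : ℕ

-- Letters and the rank of a word

letter≢top : (j : Fin m) → suc (inject₁ j) ≢ top
letter≢top j e = Fin.fromℕ≢inject₁ (sym (Fin.suc-injective e))

letter-view : {a : Fin (2 + m)} → a ≢ zero → a ≢ top → ∃[ j ] a ≡ suc (inject₁ j)
letter-view {a = zero}  a≢0 _ = contradiction refl a≢0
letter-view {a = suc i} _ a≢k = lower₁ i ne , cong suc (sym (Fin.inject₁-lower₁ i ne))
  where
  ne : _ ≢ toℕ i
  ne e = a≢k (cong suc (Fin.toℕ-injective (trans (sym e) (sym (Fin.toℕ-fromℕ _)))))

-- A letter weighs twice as much as each half of a block kk, so that every
-- step of ⟶ raises the rank by 2.
weight : Fin (2 + m) → ℕ
weight zero = 0
weight (suc i) with suc i Fin.≟ top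
... | yes _ = 1
... | no  _ = 2

weight-top : weight {m} top ≡ 1
weight-top {m} with top {suc m} Fin.≟ top
... | yes _ = refl
... | no ¬e = contradiction refl ¬e

weight-letter : {a : Fin (2 + m)} → a ≢ zero → a ≢ top → weight a ≡ 2
weight-letter {a = zero}  a≢0 _ = contradiction refl a≢0
weight-letter {a = suc i} _ a≢k with suc i Fin.≟ top
... | yes e = contradiction e a≢k
... | no  _ = refl

rank : Word (suc m) n → ℕ
rank []      = 0
rank (a ∷ w) = weight a + rank w

rank-⟶ : {w w′ : Word (suc m) n} → w ⟶ w′ → rank w′ ≡ 2 + rank w
rank-⟶ (letter a≢0 a≢k) = cong (_+ _) (weight-letter a≢0 a≢k)
rank-⟶ {m} block rewrite weight-top {m} = refl
rank-⟶ (there {a = a} {w = w} s) rewrite rank-⟶ s =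
  trans (+-suc (weight a) (suc (rank w))) (cong suc (+-suc (weight a) (rank w)))

rank-⟶³ : {w x y z : Word (suc m) n} → w ⟶ x → x ⟶ y → y ⟶ z → rank z ≡ 6 + rank w
rank-⟶³ s₁ s₂ s₃ rewrite rank-⟶ s₃ | rank-⟶ s₂ | rank-⟶ s₁ = refl

-- Three steps raise the rank by 6, a single step by 2. This and the next lemma exclude orientations
-- of a 4-cycle in which three consecutive edges point the same way.
⟶³-no-shortcut : {w x y z : Word (suc m) n} → w ⟶ x → x ⟶ y → y ⟶ z → ¬ w ⟶ z
⟶³-no-shortcut {w = w} s₁ s₂ s₃ s
  with () ← +-cancelʳ-≡ (rank w) 6 2 (trans (sym (rank-⟶³ s₁ s₂ s₃)) (rank-⟶ s))

⟶³-no-cycle : {w x y z : Word (suc m) n} → w ⟶ x → x ⟶ y → y ⟶ z → ¬ z ⟶ w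
⟶³-no-cycle {w = w} s₁ s₂ s₃ s
  with () ← +-cancelʳ-≡ (rank w) 0 8 (trans (rank-⟶ s) (cong (_+_ 2) (rank-⟶³ s₁ s₂ s₃)))

-- Common upper neighbours and orientations of 4-cycles

-- Two steps into the same word that start at the same position come from the same word. So of the
-- steps from `x` and `z` one starts where these words first differ, at a zero of one of them; the
-- letter of the other word there tells which tile is added, for `y` and `w` alike.
join-unique : {x z y w : Word (suc m) n} → x ≢ z →
              x ⟶ y → z ⟶ y → x ⟶ w → z ⟶ w → y ≡ w
join-unique x≢z (letter _ _) (letter _ _) _ _ = contradiction refl x≢z
join-unique x≢z (letter _ i≢k) block _ _ = contradiction refl i≢k
join-unique x≢z (letter i≢0 _) (there _) _ (letter _ _) = contradiction refl i≢0
join-unique x≢z (letter i≢0 _) (there _) _ block = contradiction refl i≢0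
join-unique x≢z (letter _ _) (there _) (letter _ _) (there _) = refl
join-unique x≢z (letter _ i≢k) (there _) block (there _) = contradiction refl i≢k
join-unique x≢z (letter i≢0 _) (there _) (there _) (there _) = contradiction refl i≢0
join-unique x≢z block (letter _ k≢k) _ _ = contradiction refl k≢k
join-unique x≢z block block _ _ = contradiction refl x≢z
join-unique x≢z block (there _) (letter _ k≢k) (there _) = contradiction refl k≢k
join-unique x≢z block (there _) block (there _) = refl
join-unique x≢z (there _) (letter i≢0 _) (letter _ _) _ = contradiction refl i≢0
join-unique x≢z (there _) (letter i≢0 _) block _ = contradiction refl i≢0
join-unique x≢z (there _) (letter i≢0 _) (there _) (letter _ _) = refl
join-unique x≢z (there _) (letter i≢0 i≢k) (there _) block = contradiction refl i≢k
join-unique x≢z (there _) (letter i≢0 _) (there _) (there _) = contradiction refl i≢0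
join-unique x≢z (there _) block (there _) (letter _ k≢k) = contradiction refl k≢k
join-unique x≢z (there _) block (there _) block = refl
join-unique x≢z (there _) (there _) (letter _ _) (letter _ _) = contradiction refl x≢z
join-unique x≢z (there _) (there _) (letter _ k≢k) block = contradiction refl k≢k
join-unique x≢z (there _) (there _) (letter 0≢0 _) (there _) = contradiction refl 0≢0
join-unique x≢z (there _) (there _) block (letter _ k≢k) = contradiction refl k≢k
join-unique x≢z (there _) (there _) block block = contradiction refl x≢z
join-unique x≢z (there _) (there _) (there _) (letter 0≢0 _) = contradiction refl 0≢0
join-unique x≢z (there s₁) (there s₂) (there s₃) (there s₄) =
  cong (_ ∷_) (join-unique (x≢z ∘ cong (_ ∷_)) s₁ s₂ s₃ s₄)

infix 4 _⟷_
_⟷_ : Word (suc m) n → Word (suc m) n → Set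
w ⟷ w′ = w ⟶ w′ ⊎ w′ ⟶ w

-- Suppose `z ⟶ w` instead. For the two remaining edges, each choice of orientations gives a path of
-- three steps with a shortcut, a directed cycle, or two common upper neighbours `y` and `w` of `x`
-- and `z`.
opposite-edges : {x y z w : Word (suc m) n} → x ≢ z → y ≢ w →
                 x ⟶ y → y ⟷ z → w ⟷ z → x ⟷ w → w ⟶ z
opposite-edges _ _ _ _ (inj₁ w⟶z) _ = w⟶z
opposite-edges _ _ xy (inj₁ yz) (inj₂ zw) (inj₁ xw) = contradiction xw (⟶³-no-shortcut xy yz zw)
opposite-edges _ _ xy (inj₁ yz) (inj₂ zw) (inj₂ wx) = contradiction wx (⟶³-no-cycle xy yz zw)
opposite-edges x≢z y≢w xy (inj₂ zy) (inj₂ zw) (inj₁ xw) =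
  contradiction (join-unique x≢z xy zy xw zw) y≢w
opposite-edges _ _ xy (inj₂ zy) (inj₂ zw) (inj₂ wx) = contradiction zy (⟶³-no-shortcut zw wx xy)

-- Adjacency in the hypercube and sinks of oriented cubes

-- An inductive form of `DifferOnce`, suited to recursion over the coordinates.
data Flip : Vec Bool p → Vec Bool p → Set where
  here  : {a b : Bool} {u : Vec Bool p} → a ≢ b → Flip (a ∷ u) (b ∷ u)
  there : {a : Bool} {u v : Vec Bool p} → Flip u v → Flip (a ∷ u) (a ∷ v)

Flip-sym : {u v : Vec Bool p} → Flip u v → Flip v u
Flip-sym (here a≢b) = here (a≢b ∘ sym)
Flip-sym (there f)  = there (Flip-sym f)

Flip⇒DifferOnce : {u v : Vec Bool p} → Flip u v → DifferOnce u v
Flip⇒DifferOnce (here a≢b) = zero , a≢b , λ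
  { {zero} _ → refl ; {suc j} d → contradiction refl d }
Flip⇒DifferOnce (there f) with i , d , unique ← Flip⇒DifferOnce f = suc i , d , λ
  { {zero} a≢a → contradiction refl a≢a ; {suc j} d′ → cong suc (unique d′) }

no-difference⇒≡ : {u v : Vec Bool p} → (∀ i → ¬ (lookup u i ≢ lookup v i)) → u ≡ v
no-difference⇒≡ {u = []}    {[]}    _ = refl
no-difference⇒≡ {u = a ∷ _} {b ∷ _} e =
  cong₂ _∷_ (decidable-stable (a Bool.≟ b) (e zero)) (no-difference⇒≡ (e ∘ suc))

DifferOnce⇒Flip : {u v : Vec Bool p} → DifferOnce u v → Flip u v
DifferOnce⇒Flip {u = a ∷ u} {b ∷ v} (zero , a≢b , unique)
  with refl ← no-difference⇒≡ {u = u} {v} (λ i d → contradiction (unique {suc i} d) λ ()) = here a≢b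
DifferOnce⇒Flip {u = a ∷ u} {b ∷ v} (suc i , d , unique) with a Bool.≟ b
... | yes refl = there (DifferOnce⇒Flip (i , d , λ e → Fin.suc-injective (unique {suc _} e)))
... | no a≢b with () ← unique {zero} a≢b

Flip-connected : (P : Vec Bool p → Set) → (∀ {u v} → Flip u v → P u → P v) → ∀ u v → P u → P v
Flip-connected P closed []      []      Pu = Pu
Flip-connected P closed (a ∷ u) (b ∷ v) Pu
  with Flip-connected (P ∘ (a ∷_)) (closed ∘ there) u v Pu | a Bool.≟ b
... | Pv | yes refl = Pv
... | Pv | no a≢b   = closed (here a≢b) Pv

-- All edges of the cube in the direction of the first coordinate are oriented
-- alike, so a sink of the upper of the two facets is a sink of the cube.
sink : (f : Vec Bool p → Word (suc m) n) → (∀ {u v} → f u ≡ f v → u ≡ v) →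
       (∀ {u v} → Flip u v → f u ⟷ f v) → ∃[ t ] ∀ u → Star (_⟶_ on f) u t
sink {zero}  f _ _ = [] , λ { [] → ε }
sink {suc p} f inj adj = case-sink (adj {false ∷ o} {true ∷ o} (here λ ()))
  where
  o = replicate p false

  oriented : ∀ a b → a ≢ b → f (a ∷ o) ⟶ f (b ∷ o) → ∀ v → f (a ∷ v) ⟶ f (b ∷ v)
  oriented a b a≢b s v = Flip-connected (λ u → f (a ∷ u) ⟶ f (b ∷ u))
    -- The 4-cycle has the corners `a ∷ u`, `b ∷ u`, `b ∷ v`, `a ∷ v`, where `u` and `v` are
    -- neighbours.
    (λ uv s → opposite-edges (a≢b ∘ Vec.∷-injectiveˡ ∘ inj) (a≢b ∘ sym ∘ Vec.∷-injectiveˡ ∘ inj) s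
                (adj (there uv)) (adj (here a≢b)) (adj (there uv))) o v s

  extend : ∀ a b → a ≢ b → f (a ∷ o) ⟶ f (b ∷ o) → ∃[ t ] ∀ u → Star (_⟶_ on f) u t
  extend a b a≢b s
    with t , reach ← sink (f ∘ (b ∷_)) (Vec.∷-injectiveʳ ∘ inj) (adj ∘ there) = b ∷ t , go
    where
    go : ∀ u → Star (_⟶_ on f) u (b ∷ t)
    go (c ∷ u) with c Bool.≟ b
    ... | yes refl = gmap (b ∷_) (λ x → x) (reach u)
    -- Both `c` and `a` differ from `b`, so they agree: one step crosses into the facet of `b`, and
    -- the path to its sink follows.
    ... | no  c≢b with refl ← trans (Bool.¬-not c≢b) (sym (Bool.¬-not a≢b)) =
      oriented a b a≢b s u ◅ gmap (b ∷_) (λ x → x) (reach u)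

  case-sink : f (false ∷ o) ⟷ f (true ∷ o) → ∃[ t ] ∀ u → Star (_⟶_ on f) u t
  case-sink (inj₁ s) = extend false true (λ ()) s
  case-sink (inj₂ s) = extend true false (λ ()) s

-- Full tilings and their cubes of sub-tilings

-- `Fin m` stands for the letters from 1 to k-1, so that k is `suc m`; `p` counts the tiles and is
-- thus the dimension of the cube that `fill` parametrizes.
data Tiling (m : ℕ) : ℕ → ℕ → Set where
  []  : Tiling m 0 0
  one : Fin m → Tiling m n p → Tiling m (suc n) (suc p)
  two : Tiling m n p → Tiling m (2 + n) (suc p)

fill : Tiling m n p → Vec Bool p → Word (suc m) n
fill []        []          = []
fill (one j T) (false ∷ u) = zero ∷ fill T u
fill (one j T) (true  ∷ u) = suc (inject₁ j) ∷ fill T u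
fill (two T)   (false ∷ u) = zero ∷ zero ∷ fill T u
fill (two T)   (true  ∷ u) = top ∷ top ∷ fill T u

fill-blocks : (T : Tiling m n p) (u : Vec Bool p) → Blocks (toList (fill T u))
fill-blocks []        []          = []
fill-blocks (one j T) (false ∷ u) = (λ ()) ∷ fill-blocks T u
fill-blocks (one j T) (true  ∷ u) = letter≢top j ∷ fill-blocks T u
fill-blocks (two T)   (false ∷ u) = (λ ()) ∷ (λ ()) ∷ fill-blocks T u
fill-blocks (two T)   (true  ∷ u) = kk∷ fill-blocks T u

fill-adjacent : (T : Tiling m n p) {u v : Vec Bool p} → Flip u v → fill T u ⟷ fill T v
fill-adjacent (one j T) (here {a = false} {false} a≢b) = contradiction refl a≢b
fill-adjacent (one j T) (here {a = false} {true} a≢b) = inj₁ (letter (λ ()) (letter≢top j))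
fill-adjacent (one j T) (here {a = true} {false} a≢b) = inj₂ (letter (λ ()) (letter≢top j))
fill-adjacent (one j T) (here {a = true} {true} a≢b) = contradiction refl a≢b
fill-adjacent (two T)   (here {a = false} {false} a≢b) = contradiction refl a≢b
fill-adjacent (two T)   (here {a = false} {true} a≢b) = inj₁ block
fill-adjacent (two T)   (here {a = true} {false} a≢b) = inj₂ block
fill-adjacent (two T)   (here {a = true} {true} a≢b) = contradiction refl a≢b
fill-adjacent (one j T) (there {a = false} f) = Sum.map there there (fill-adjacent T f)
fill-adjacent (one j T) (there {a = true}  f) = Sum.map there there (fill-adjacent T f)
fill-adjacent (two T)   (there {a = false} f) =
  Sum.map (λ s → there (there s)) (λ s → there (there s)) (fill-adjacent T f)
fill-adjacent (two T)   (there {a = true}  f) =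
  Sum.map (λ s → there (there s)) (λ s → there (there s)) (fill-adjacent T f)

fill-injective : (T : Tiling m n p) (u v : Vec Bool p) → fill T u ≡ fill T v → u ≡ v
fill-injective []        []          []          _ = refl
fill-injective (one j T) (false ∷ u) (false ∷ v) e = cong (false ∷_) (fill-injective T u v (Vec.∷-injectiveʳ e))
fill-injective (one j T) (false ∷ u) (true  ∷ v) e with () ← Vec.∷-injectiveˡ e
fill-injective (one j T) (true  ∷ u) (false ∷ v) e with () ← Vec.∷-injectiveˡ e
fill-injective (one j T) (true  ∷ u) (true  ∷ v) e = cong (true ∷_) (fill-injective T u v (Vec.∷-injectiveʳ e))
fill-injective (two T)   (false ∷ u) (false ∷ v) e =
  cong (false ∷_) (fill-injective T u v (Vec.∷-injectiveʳ (Vec.∷-injectiveʳ e)))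
fill-injective (two T)   (false ∷ u) (true  ∷ v) e with () ← Vec.∷-injectiveˡ e
fill-injective (two T)   (true  ∷ u) (false ∷ v) e with () ← Vec.∷-injectiveˡ e
fill-injective (two T)   (true  ∷ u) (true  ∷ v) e =
  cong (true ∷_) (fill-injective T u v (Vec.∷-injectiveʳ (Vec.∷-injectiveʳ e)))

⟶-there⁻ : {a : Fin (2 + m)} {w w′ : Word (suc m) n} → a ∷ w ⟶ a ∷ w′ → w ⟶ w′
⟶-there⁻ (letter 0≢0 _) = contradiction refl 0≢0
⟶-there⁻ (there s)      = s

⟶-letter⁻ : {a b : Fin (2 + m)} {w w′ : Word (suc m) n} → a ≢ b → b ≢ top → a ∷ w ⟶ b ∷ w′ → w ≡ w′
⟶-letter⁻ _   _   (letter _ _) = refl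
⟶-letter⁻ _   b≢k block        = contradiction refl b≢k
⟶-letter⁻ a≢a _   (there _)    = contradiction refl a≢a

⟶-block⁻ : {w w′ : Word (suc m) n} → zero ∷ zero ∷ w ⟶ top ∷ top ∷ w′ → w ≡ w′
⟶-block⁻ block = refl

¬⟶-zero : {i : Fin (suc m)} {w w′ : Word (suc m) n} → ¬ suc i ∷ w ⟶ zero ∷ w′
¬⟶-zero ()

-- Needed for the cube of a tiling to be an induced subgraph. If the first bits differ, the step
-- adds the first tile, so the remaining words and hence the remaining bits agree.
fill-adjacent⁻ : (T : Tiling m n p) (u v : Vec Bool p) → fill T u ⟶ fill T v → Flip u v
fill-adjacent⁻ []        []          []          ()
fill-adjacent⁻ (one j T) (false ∷ u) (false ∷ v) s = there (fill-adjacent⁻ T u v (⟶-there⁻ s))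
fill-adjacent⁻ (one j T) (false ∷ u) (true  ∷ v) s
  with refl ← fill-injective T u v (⟶-letter⁻ (λ ()) (letter≢top j) s) = here λ ()
fill-adjacent⁻ (one j T) (true  ∷ u) (false ∷ v) s = contradiction s ¬⟶-zero
fill-adjacent⁻ (one j T) (true  ∷ u) (true  ∷ v) s = there (fill-adjacent⁻ T u v (⟶-there⁻ s))
fill-adjacent⁻ (two T)   (false ∷ u) (false ∷ v) s = there (fill-adjacent⁻ T u v (⟶-there⁻ (⟶-there⁻ s)))
fill-adjacent⁻ (two T)   (false ∷ u) (true  ∷ v) s
  with refl ← fill-injective T u v (⟶-block⁻ s) = here λ ()
fill-adjacent⁻ (two T)   (true  ∷ u) (false ∷ v) s = contradiction s ¬⟶-zero
fill-adjacent⁻ (two T)   (true  ∷ u) (true  ∷ v) s = there (fill-adjacent⁻ T u v (⟶-there⁻ (⟶-there⁻ s)))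

-- Removing tiles and extending to full tilings

⟶-∷⁻ : {b : Fin (2 + m)} {w : Word (suc m) (suc n)} {x : Word (suc m) n} → b ≢ top → w ⟶ b ∷ x →
       (b ≢ zero × w ≡ zero ∷ x) ⊎ ∃[ w′ ] (w ≡ b ∷ w′ × w′ ⟶ x)
⟶-∷⁻ b≢k (letter b≢0 _) = inj₁ (b≢0 , refl)
⟶-∷⁻ b≢k block          = contradiction refl b≢k
⟶-∷⁻ b≢k (there s)      = inj₂ (_ , refl , s)

Blocks-∷⁻ : {a : Fin (suc m)} {w : List (Fin (suc m))} → a ≢ top → Blocks (a ∷ w) → Blocks w
Blocks-∷⁻ _   (_ ∷ b) = b
Blocks-∷⁻ k≢k (kk∷ _) = contradiction refl k≢k

Blocks-kk∷⁻ : {w : List (Fin (suc m))} → Blocks (top ∷ top ∷ w) → Blocks w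
Blocks-kk∷⁻ (k≢k ∷ _) = contradiction refl k≢k
Blocks-kk∷⁻ (kk∷ b)   = b

¬Blocks-k0∷ : {w : List (Fin (2 + m))} → ¬ Blocks (top ∷ zero ∷ w)
¬Blocks-k0∷ (k≢k ∷ _) = k≢k refl

-- The danger is a step from k00 to kkk, whose new block straddles the end of the leading pair. Its
-- source has a leading run of a single k, which `Blocks` forbids.
⟶-kk∷⁻ : {w : Word (suc m) (2 + n)} {x : Word (suc m) n} → Blocks (toList w) → w ⟶ top ∷ top ∷ x →
         w ≡ zero ∷ zero ∷ x ⊎ ∃[ w′ ] (w ≡ top ∷ top ∷ w′ × w′ ⟶ x)
⟶-kk∷⁻ _ (letter _ k≢k)         = contradiction refl k≢k
⟶-kk∷⁻ _ block                  = inj₁ refl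
⟶-kk∷⁻ _ (there (letter _ k≢k)) = contradiction refl k≢k
⟶-kk∷⁻ b (there block)          = contradiction b ¬Blocks-k0∷
⟶-kk∷⁻ _ (there (there s))      = inj₂ (_ , refl , s)

infix 4 _∈fill_
_∈fill_ : Word (suc m) n → Tiling m n p → Set
w ∈fill T = ∃[ u ] fill T u ≡ w

_∈fill?_ : (w : Word (suc m) n) (T : Tiling m n p) → Dec (w ∈fill T)
w ∈fill? T = anyBits? λ u → Vec.≡-dec Fin._≟_ (fill T u) w

-- Runs of k split into blocks in only one way from the left, so a Pell string below `fill T v` can
-- only have lost one of the tiles of `T` that `v` keeps.
∈fill-down : (T : Tiling m n p) (v : Vec Bool p) {w : Word (suc m) n} →
             Blocks (toList w) → w ⟶ fill T v → w ∈fill T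
∈fill-down []        []          b ()
∈fill-down (one j T) (false ∷ v) b s with ⟶-∷⁻ (λ ()) s
... | inj₁ (0≢0 , _) = contradiction refl 0≢0
... | inj₂ (w , refl , s′) with u , refl ← ∈fill-down T v (Blocks-∷⁻ (λ ()) b) s′ = false ∷ u , refl
∈fill-down (one j T) (true  ∷ v) b s with ⟶-∷⁻ (letter≢top j) s
... | inj₁ (_ , refl) = false ∷ v , refl
... | inj₂ (w , refl , s′) with u , refl ← ∈fill-down T v (Blocks-∷⁻ (letter≢top j) b) s′ = true ∷ u , refl
∈fill-down (two T)   (false ∷ v) b s with ⟶-∷⁻ (λ ()) s
... | inj₁ (0≢0 , _) = contradiction refl 0≢0
... | inj₂ (_ , refl , s′) with ⟶-∷⁻ (λ ()) s′
...   | inj₁ (0≢0 , _) = contradiction refl 0≢0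
...   | inj₂ (w , refl , s″)
        with u , refl ← ∈fill-down T v (Blocks-∷⁻ (λ ()) (Blocks-∷⁻ (λ ()) b)) s″ = false ∷ u , refl
∈fill-down (two T)   (true  ∷ v) b s with ⟶-kk∷⁻ b s
... | inj₁ refl = false ∷ v , refl
... | inj₂ (w , refl , s′) with u , refl ← ∈fill-down T v (Blocks-kk∷⁻ b) s′ = true ∷ u , refl

Extendable : Word (2 + m) n → Set
Extendable w = ∃[ p ] ∃[ T ] _∈fill_ {p = p} w T

-- A zero is covered by the letter 1, which is not k since k ≥ 2.
extendable-∷ : {a : Fin (3 + m)} {w : Word (2 + m) n} → a ≢ top → Extendable w → Extendable (a ∷ w)
extendable-∷ {a = a} a≢k (p , T , u , refl) with a Fin.≟ zero
... | yes refl = suc p , one zero T , false ∷ u , refl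
... | no a≢0 with j , refl ← letter-view a≢0 a≢k = suc p , one j T , true ∷ u , refl

extendable : (w : Word (2 + m) n) → Blocks (toList w) → Extendable w
extendable []          b         = 0 , [] , [] , refl
extendable (a ∷ [])    (a≢k ∷ b) = extendable-∷ a≢k (extendable [] b)
extendable (a ∷ c ∷ w) (a≢k ∷ b) = extendable-∷ a≢k (extendable (c ∷ w) b)
extendable (_ ∷ _ ∷ w) (kk∷ b) with p , T , u , refl ← extendable w b =
  suc p , two T , true ∷ u , refl

-- The word that keeps all tiles of `T` has no zero, so `T′` drops no tile either, and reading
-- letters and pairs kk from the left recovers the same tiles. The equality of pairs yields `p ≡ q`
-- as well.
full-fill-determines : ∀ {m n p q} (T : Tiling m n p) (T′ : Tiling m n q) →
                       fill T (replicate p true) ∈fill T′ → _≡_ {A = ∃ (Tiling m n)} (p , T) (q , T′)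
full-fill-determines []        []         _ = refl
full-fill-determines (one i T) (one j T′) (false ∷ u , e) with () ← Vec.∷-injectiveˡ e
full-fill-determines (one i T) (one j T′) (true  ∷ u , e)
  with refl ← Fin.inject₁-injective (Fin.suc-injective (Vec.∷-injectiveˡ e))
     | refl ← full-fill-determines T T′ (u , Vec.∷-injectiveʳ e) = refl
full-fill-determines (one i T) (two T′)   (false ∷ u , e) with () ← Vec.∷-injectiveˡ e
full-fill-determines (one i T) (two T′)   (true  ∷ u , e) =
  contradiction (sym (Vec.∷-injectiveˡ e)) (letter≢top i)
full-fill-determines (two T)   (one j T′) (false ∷ u , e) with () ← Vec.∷-injectiveˡ e
full-fill-determines (two T)   (one j T′) (true  ∷ u , e) =
  contradiction (Vec.∷-injectiveˡ e) (letter≢top j)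
full-fill-determines (two T)   (two T′)   (false ∷ u , e) with () ← Vec.∷-injectiveˡ e
full-fill-determines (two T)   (two T′)   (true  ∷ u , e)
  with refl ← full-fill-determines T T′ (u , Vec.∷-injectiveʳ (Vec.∷-injectiveʳ e)) = refl

-- Comparing dimensions by cardinality

encode : Vec Bool p → Fin (2 ^ p)
encode []      = zero
encode (b ∷ u) = combine (Inverse.from Fin.2↔Bool b) (encode u)

encode-injective : (u v : Vec Bool p) → encode u ≡ encode v → u ≡ v
encode-injective []      []      _ = refl
encode-injective (a ∷ u) (b ∷ v) e with eˡ , eʳ ← Fin.combine-injective _ (encode u) _ (encode v) e =
  cong₂ _∷_ (Injection.injective (↔⇒↣ (↔-sym Fin.2↔Bool)) eˡ) (encode-injective u v eʳ)

decode : Fin (2 ^ p) → Vec Bool p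
decode {zero}  i = []
decode {suc p} i = Inverse.to Fin.2↔Bool (quotient {2} (2 ^ p) i) ∷ decode (remainder {2} (2 ^ p) i)

encode-decode : (i : Fin (2 ^ p)) → encode {p} (decode i) ≡ i
encode-decode {zero}  zero = refl
encode-decode {suc p} i    = trans
  (cong₂ combine (Inverse.strictlyInverseʳ Fin.2↔Bool (quotient {2} (2 ^ p) i))
                 (encode-decode {p} (remainder {2} (2 ^ p) i)))
  (Fin.combine-remQuot {2} (2 ^ p) i)

-- Pigeonhole principle: if `q < p`, then `f` between binary codes would inject `Fin (2 ^ p)` into
-- the smaller `Fin (2 ^ q)`.
Vec-Bool-injection⇒≤ : (f : Vec Bool p → Vec Bool q) → (∀ {u v} → f u ≡ f v → u ≡ v) → p ≤ q
Vec-Bool-injection⇒≤ {p} f f-inj = ≮⇒≥ λ q<p →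
  Fin.<⇒notInjective {f = encode ∘ f ∘ decode} (^-monoʳ-< 2 (s≤s (s≤s z≤n)) q<p)
    λ {i} {j} e → trans (sym (encode-decode {p} i))
      (trans (cong encode (f-inj (encode-injective _ _ e))) (encode-decode {p} j))

-- Counting by enumeration, and the number of tilings

-- Two duplicate-free lists with the same members are permutations of each other. This will count
-- the maximal cubes through the tilings.
length-filter-bijection : ∀ {A B : Set} {P : A → Set} (P? : ∀ a → Dec (P a)) (f : B → A) {xs ys} →
  Unique xs → (∀ a → a ∈ˡ xs) → Unique ys → (∀ b → b ∈ˡ ys) →
  (∀ {b b′} → f b ≡ f b′ → b ≡ b′) → (∀ b → P (f b)) → (∀ {a} → P a → ∃[ b ] a ≡ f b) →
  length (filter P? xs) ≡ length ys
length-filter-bijection P? f {xs} {ys} xs! xs-all ys! ys-all f-inj sound onto = trans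
  (↭-length (∼bag⇒↭ (unique∧set⇒bag (Unique.filter⁺ P? xs!) (Unique.map⁺ f-inj ys!) (mk⇔ to from))))
  (length-map f ys)
  where
  to : ∀ {a} → a ∈ˡ filter P? xs → a ∈ˡ List.map f ys
  to a∈ with b , refl ← onto (proj₂ (∈-filter⁻ P? {xs = xs} a∈)) = ∈-map⁺ f (ys-all b)

  from : ∀ {a} → a ∈ˡ List.map f ys → a ∈ˡ filter P? xs
  from a∈ with b , _ , refl ← ∈-map⁻ f a∈ = ∈-filter⁺ P? (xs-all (f b)) (sound b)

length-cartesianProductWith : ∀ {A B C : Set} (f : A → B → C) xs ys →
  length (cartesianProductWith f xs ys) ≡ length xs * length ys
length-cartesianProductWith f []       ys = refl
length-cartesianProductWith f (x ∷ xs) ys = trans (length-++ (List.map (f x) ys))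
  (cong₂ _+_ (length-map (f x) ys) (length-cartesianProductWith f xs ys))

tilings : ∀ m n p → List (Tiling m n p)
tilings m zero          zero    = [] ∷ []
tilings m zero          (suc p) = []
tilings m (suc n)       zero    = []
tilings m (suc zero)    (suc p) = cartesianProductWith one (allFin m) (tilings m zero p)
tilings m (suc (suc n)) (suc p) =
  cartesianProductWith one (allFin m) (tilings m (suc n) p) ++ List.map two (tilings m n p)

∈-tilings : (T : Tiling m n p) → T ∈ˡ tilings m n p
∈-tilings [] = here refl
∈-tilings (one {n = zero}  j T) = ∈-cartesianProductWith⁺ one (∈-allFin j) (∈-tilings T)
∈-tilings (one {n = suc n} j T) = ∈-++⁺ˡ (∈-cartesianProductWith⁺ one (∈-allFin j) (∈-tilings T))
∈-tilings {m} (two {n = n} {p} T) =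
  ∈-++⁺ʳ (cartesianProductWith one (allFin m) (tilings m (suc n) p)) (∈-map⁺ two (∈-tilings T))

one-injective : {i j : Fin m} {T T′ : Tiling m n p} → one i T ≡ one j T′ → i ≡ j × T ≡ T′
one-injective refl = refl , refl

two-injective : {T T′ : Tiling m n p} → two T ≡ two T′ → T ≡ T′
two-injective refl = refl

tilings-unique : ∀ m n p → Unique (tilings m n p)
tilings-unique m zero          zero    = All.[] ∷ []
tilings-unique m zero          (suc p) = []
tilings-unique m (suc n)       zero    = []
tilings-unique m (suc zero)    (suc p) =
  Unique.cartesianProductWith⁺ one one-injective (Unique.allFin⁺ m) (tilings-unique m zero p)
tilings-unique m (suc (suc n)) (suc p) = Unique.++⁺
  (Unique.cartesianProductWith⁺ one one-injective (Unique.allFin⁺ m) (tilings-unique m (suc n) p))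
  (Unique.map⁺ two-injective (tilings-unique m n p))
  disjoint
  where
  disjoint : Disjoint (cartesianProductWith one (allFin m) (tilings m (suc n) p))
                      (List.map two (tilings m n p))
  disjoint (T∈ , T∈′) with ∈-cartesianProductWith⁻ one (allFin m) (tilings m (suc n) p) T∈ | ∈-map⁻ two T∈′
  ... | _ , _ , _ , _ , refl | _ , _ , ()

#tilings : ℕ → ℕ → ℕ → ℕ
#tilings m n p = length (tilings m n p)

#tilings-1 : ∀ m p → #tilings m 1 (suc p) ≡ m * #tilings m 0 p
#tilings-1 m p = trans (length-cartesianProductWith one (allFin m) (tilings m 0 p))
  (cong (_* #tilings m 0 p) (length-tabulate {n = m} (λ i → i)))

#tilings-2+ : ∀ m n p → #tilings m (2 + n) (suc p) ≡ m * #tilings m (suc n) p + #tilings m n p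
#tilings-2+ m n p = trans (length-++ (cartesianProductWith one (allFin m) (tilings m (suc n) p)))
  (cong₂ _+_
    (trans (length-cartesianProductWith one (allFin m) (tilings m (suc n) p))
      (cong (_* #tilings m (suc n) p) (length-tabulate {n = m} (λ i → i))))
    (length-map two (tilings m n p)))

-- Maximal cubes of the Munarini graph

module _ (G : FinGraph) {p q : ℕ} {S : Subset (FinGraph.size G)} where

  -- Going along one cube map and back along the other is injective on bit vectors. Applied both
  -- ways, this shows that the vertex set determines the dimension.
  cube-dim-≤ : IsCube G p S → IsCube G q S → p ≤ q
  cube-dim-≤ c d
    with f , cubeMap f-lands _ f-inj _ ← isCube⇒cubeMap G {S = S} c
       | g , cubeMap _ g-onto _ _ ← isCube⇒cubeMap G {S = S} d =
    Vec-Bool-injection⇒≤ (λ u → proj₁ (g-onto (f u) (f-lands u)))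
      λ {u} {v} e → f-inj u v (trans (sym (proj₂ (g-onto (f u) (f-lands u))))
        (trans (cong g e) (proj₂ (g-onto (f v) (f-lands v)))))

-- The enumeration of the vertices is kept abstract, so that it is never unfolded.
module MunariniCubes (m n size : ℕ) (enum : Fin size ↔ PellString n (2 + m)) where

  G : FinGraph
  G = record
    { graph = FinGraph.graph (M n (2 + m))
    ; _~?_  = FinGraph._~?_ (M n (2 + m))
    ; size  = size
    ; enum  = enum
    }

  open FinGraph G using (vertex; index; index-vertex; vertex-index; _~_)

  fillString : Tiling (suc m) n p → Vec Bool p → PellString n (2 + m)
  fillString T u = pellString (fill T u) (blocks⇒runs (fill-blocks T u))

  word-blocks : (s : PellString n (2 + m)) → Blocks (toList (word s))
  word-blocks (pellString w r) = runs⇒blocks (toList w) (recompute (isPell? w) r)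

  vertex-injective : ∀ {i j} → vertex i ≡ vertex j → i ≡ j
  vertex-injective {i} {j} e = trans (sym (index-vertex i)) (trans (cong index e) (index-vertex j))

  index-injective : ∀ {s t} → index s ≡ index t → s ≡ t
  index-injective {s} {t} e = trans (sym (vertex-index s)) (trans (cong vertex e) (vertex-index t))

  cube : Tiling (suc m) n p → Subset size
  cube T = tabulate (λ i → does (word (vertex i) ∈fill? T))

  ∈cube⁺ : ∀ {i} {T : Tiling (suc m) n p} → word (vertex i) ∈fill T → i ∈ cube T
  ∈cube⁺ {i = i} {T} r = Vec.lookup⇒[]= i (cube T) (trans (Vec.lookup∘tabulate _ i) (dec-true (_ ∈fill? T) r))

  ∈cube⁻ : ∀ {i} {T : Tiling (suc m) n p} → i ∈ cube T → word (vertex i) ∈fill T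
  ∈cube⁻ {i = i} {T} i∈ with word (vertex i) ∈fill? T in eq
  ... | yes r = r
  ... | no  _ = contradiction
    (trans (sym (Vec.[]=⇒lookup i∈)) (trans (Vec.lookup∘tabulate _ i) (cong does eq))) λ ()

  cube-isCube : (T : Tiling (suc m) n p) → IsCube G p (cube T)
  cube-isCube T = cubeMap⇒isCube G {S = cube T} (index ∘ fillString T , cubeMap
    (λ u → ∈cube⁺ (u , cong word (sym (vertex-index (fillString T u)))))
    (λ i i∈ → let u , e = ∈cube⁻ i∈ in
       u , trans (cong index (word-injective e)) (index-vertex i))
    (λ u v e → fill-injective T u v (cong word (index-injective e)))
    (λ u v → (λ d → subst₂ _~_ (sym (vertex-index _)) (sym (vertex-index _))
                      (fill-adjacent T (DifferOnce⇒Flip d)))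
           , (λ s → adjacent⁻ u v (subst₂ _~_ (vertex-index _) (vertex-index _) s))))
    where
    adjacent⁻ : ∀ u v → fill T u ⟷ fill T v → DifferOnce u v
    adjacent⁻ u v (inj₁ s) = Flip⇒DifferOnce (fill-adjacent⁻ T u v s)
    adjacent⁻ u v (inj₂ s) = Flip⇒DifferOnce (Flip-sym (fill-adjacent⁻ T v u s))

  ∈fill-descend : (f : Vec Bool p → PellString n (2 + m)) (T : Tiling (suc m) n q) →
    ∀ {u v} → Star (_⟶_ on (word ∘ f)) u v → word (f v) ∈fill T → word (f u) ∈fill T
  ∈fill-descend f T ε       v∈ = v∈
  ∈fill-descend f T {u} (s ◅ r) v∈ with x , e ← ∈fill-descend f T r v∈ =
    ∈fill-down T x (word-blocks (f u)) (subst (_ ⟶_) (sym e) s)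

  -- Take a tiling that extends the sink of the cube: each vertex has a chain of steps up to the
  -- sink, and the cube of a tiling is closed under going down.
  cube-⊆-tiling : ∀ {S} → IsCube G p S → ∃[ q ] ∃[ T ] S ⊆ cube {q} T
  cube-⊆-tiling {S = S} c
    with f , cubeMap _ onto f-inj adj ← isCube⇒cubeMap G {S = S} c
    with t , reach ← sink (word ∘ vertex ∘ f)
           (λ e → f-inj _ _ (vertex-injective (word-injective e)))
           (λ {u} {v} d → proj₁ (adj u v) (Flip⇒DifferOnce d))
    with q , T , t∈ ← extendable (word (vertex (f t))) (word-blocks (vertex (f t))) =
    q , T , λ {i} i∈ → let u , e = onto i i∈ in
      subst (_∈ cube T) e (∈cube⁺ (∈fill-descend (vertex ∘ f) T (reach u) t∈))

  -- The vertex with all tiles of `T` already decides. So cubes of different tilings are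
  -- incomparable, which serves both injectivity and maximality.
  cube-⊆⇒≡ : (T : Tiling (suc m) n p) (T′ : Tiling (suc m) n q) → cube T ⊆ cube T′ →
             _≡_ {A = ∃ (Tiling (suc m) n)} (p , T) (q , T′)
  cube-⊆⇒≡ {p} T T′ T⊆T′ = full-fill-determines T T′
    (subst (_∈fill T′) full (∈cube⁻ (T⊆T′ (∈cube⁺ (replicate p true , sym full)))))
    where
    full : word (vertex (index (fillString T (replicate p true)))) ≡ fill T (replicate p true)
    full = cong word (vertex-index _)

  cube-injective : {T T′ : Tiling (suc m) n p} → cube T ≡ cube T′ → T ≡ T′
  cube-injective {T = T} {T′} e with refl ← cube-⊆⇒≡ T T′ (λ {i} → subst (i ∈_) e) = refl

  cube-isMaximal : (T : Tiling (suc m) n p) → IsMaximalCube G p (cube T)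
  cube-isMaximal T = cube-isCube T , not-below
    where
    not-below : ¬ (∃[ q ] ∃[ S ] (IsCube G q S × cube T ⊂ S))
    not-below (q , S , c , T⊆S , i , i∈S , i∉T)
      -- `S` is squeezed between `cube T` and `cube T′`. The two tilings then coincide, and no room
      -- is left for the extra vertex `i`.
      with r , T′ , S⊆T′ ← cube-⊆-tiling {S = S} c
      with refl ← cube-⊆⇒≡ T T′ (λ i∈ → S⊆T′ (T⊆S i∈)) = i∉T (S⊆T′ i∈S)

  maximal⇒cube : ∀ {S} → IsMaximalCube G p S → ∃[ T ] S ≡ cube {p} T
  maximal⇒cube {p} {S} (c , maximal) with q , T , S⊆T ← cube-⊆-tiling {S = S} c
    -- A vertex of `cube T` outside `S` would make `cube T` a larger cube, against maximality.
    with refl ← ⊆-antisym S⊆T (λ {i} i∈T → decidable-stable (i ∈? S) λ i∉S →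
                  maximal (q , cube T , cube-isCube T , S⊆T , i , i∈T , i∉S))
    with refl ← ≤-antisym (cube-dim-≤ G {S = cube T} c (cube-isCube T))
                          (cube-dim-≤ G {S = cube T} (cube-isCube T) c) = T , refl

  h≡#tilings : ∀ p → h G p ≡ #tilings (suc m) n p
  h≡#tilings p = length-filter-bijection (isMaximalCube? G p) cube
    (allSubsets-unique size) allSubsets-complete (tilings-unique (suc m) n p) ∈-tilings
    cube-injective cube-isMaximal (λ {S} → maximal⇒cube {S = S})

  coeff-H≡#tilings : ∀ K → K ≡ G → ∀ p → coeff (H K) p ≡ + #tilings (suc m) n p
  coeff-H≡#tilings K refl p = trans (coeff-H K p) (cong +_ (h≡#tilings p))

-- Both sides of K ≡ G unfold to the same record, but the conversion checker
-- cannot afford to compare the unfolded polynomials H K and H G.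
coeff-H-Munarini : ∀ k (2≤k : 2 ≤ k) n p →
  coeff (H (M n k {{>-nonZero (<⇒≤ 2≤k)}})) p ≡ + #tilings (k ∸ 1) n p
coeff-H-Munarini (suc (suc m)) 2≤k@(s≤s (s≤s z≤n)) n =
  MunariniCubes.coeff-H≡#tilings m n _ (pellEnum n (2 + m)) (M n (suc (suc m)) {{>-nonZero (<⇒≤ 2≤k)}}) refl

-- Coefficients of polynomials and of products of series

coeff-+ₚ : ∀ f g i → coeff (f +ₚ g) i ≡ coeff f i ℤ.+ coeff g i
coeff-+ₚ []      g       i       = sym (ℤ.+-identityˡ _)
coeff-+ₚ (a ∷ f) []      i       = sym (ℤ.+-identityʳ _)
coeff-+ₚ (a ∷ f) (b ∷ g) zero    = refl
coeff-+ₚ (a ∷ f) (b ∷ g) (suc i) = coeff-+ₚ f g i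

coeff-*ₚ0ₚ : ∀ f i → coeff (f *ₚ 0ₚ) i ≡ 0ℤ
coeff-*ₚ0ₚ []      i       = refl
coeff-*ₚ0ₚ (a ∷ f) zero    = refl
coeff-*ₚ0ₚ (a ∷ f) (suc i) = coeff-*ₚ0ₚ f i

coeff-*ₚ1ₚ : ∀ f i → coeff (f *ₚ 1ₚ) i ≡ coeff f i
coeff-*ₚ1ₚ []      i       = refl
coeff-*ₚ1ₚ (a ∷ f) zero    = trans (ℤ.+-identityʳ _) (ℤ.*-identityʳ a)
coeff-*ₚ1ₚ (a ∷ f) (suc i) = coeff-*ₚ1ₚ f i

coeff-*ₚ·x-zero : ∀ f a → coeff (f *ₚ a ·x) 0 ≡ 0ℤ
coeff-*ₚ·x-zero []      a = refl
coeff-*ₚ·x-zero (b ∷ f) a = trans (ℤ.+-identityʳ _) (ℤ.*-zeroʳ b)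

coeff-*ₚ·x-suc : ∀ f a i → coeff (f *ₚ a ·x) (suc i) ≡ coeff f i ℤ.* a
coeff-*ₚ·x-suc []      a i       = sym (ℤ.*-zeroˡ a)
coeff-*ₚ·x-suc (b ∷ f) a zero    = trans (coeff-+ₚ (b ℤ.* a ∷ []) (f *ₚ a ·x) 0)
  (trans (cong (λ z → b ℤ.* a ℤ.+ z) (coeff-*ₚ·x-zero f a)) (ℤ.+-identityʳ _))
coeff-*ₚ·x-suc (b ∷ f) a (suc i) = trans (coeff-+ₚ (b ℤ.* a ∷ []) (f *ₚ a ·x) (suc i))
  (trans (ℤ.+-identityˡ _) (coeff-*ₚ·x-suc f a i))

Σₚ : (ℕ → Poly) → ℕ → Poly
Σₚ F n = foldr _+ₚ_ 0ₚ (applyUpTo F n)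

*ₛ-Σₚ : ∀ A B n → (A *ₛ B) n ≡ Σₚ (λ i → A i *ₚ B (n ∸ i)) (suc n)
*ₛ-Σₚ A B n = cong (foldr _+ₚ_ 0ₚ) (map-upTo (λ i → A i *ₚ B (n ∸ i)) (suc n))

-- `foldr` exposes the first summand, but in the convolution with the denominator the surviving
-- summands are the last ones.
coeff-Σₚ-suc : ∀ F n i → coeff (Σₚ F (suc n)) i ≡ coeff (Σₚ F n) i ℤ.+ coeff (F n) i
coeff-Σₚ-suc F zero    i = trans (coeff-+ₚ (F 0) 0ₚ i) (ℤ.+-comm (coeff (F 0) i) 0ℤ)
coeff-Σₚ-suc F (suc n) i = trans (coeff-+ₚ (F 0) _ i)
  (trans (cong (λ z → coeff (F 0) i ℤ.+ z) (coeff-Σₚ-suc (F ∘ suc) n i))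
  (trans (sym (ℤ.+-assoc (coeff (F 0) i) _ _))
  (cong (ℤ._+ coeff (F (suc n)) i) (sym (coeff-+ₚ (F 0) _ i)))))

coeff-Σₚ-zero : ∀ F n i → (∀ j → j < n → coeff (F j) i ≡ 0ℤ) → coeff (Σₚ F n) i ≡ 0ℤ
coeff-Σₚ-zero F zero    i z = refl
coeff-Σₚ-zero F (suc n) i z = trans (coeff-Σₚ-suc F n i)
  (cong₂ ℤ._+_ (coeff-Σₚ-zero F n i λ j j<n → z j (m<n⇒m<1+n j<n)) (z n ≤-refl))

module _ (A D : Series) (i : ℕ) where

  private
    term : ℕ → ℕ → Poly
    term n j = A j *ₚ D (n ∸ j)

  coeff-*ₛ-0 : coeff ((A *ₛ D) 0) i ≡ coeff (A 0 *ₚ D 0) i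
  coeff-*ₛ-0 = trans (coeff-Σₚ-suc (term 0) 0 i) (ℤ.+-identityˡ _)

  coeff-*ₛ-1 : coeff ((A *ₛ D) 1) i ≡ coeff (A 0 *ₚ D 1) i ℤ.+ coeff (A 1 *ₚ D 0) i
  coeff-*ₛ-1 = trans (coeff-Σₚ-suc (term 1) 1 i)
    (cong (ℤ._+ coeff (A 1 *ₚ D 0) i) (trans (coeff-Σₚ-suc (term 1) 0 i) (ℤ.+-identityˡ (coeff (A 0 *ₚ D 1) i))))

  -- As `D` has degree at most 2 in t, only the last three summands of the convolution survive.
  coeff-*ₛ-2+ : (∀ j → D (3 + j) ≡ 0ₚ) → ∀ n → coeff ((A *ₛ D) (2 + n)) i ≡
    coeff (A n *ₚ D 2) i ℤ.+ coeff (A (1 + n) *ₚ D 1) i ℤ.+ coeff (A (2 + n) *ₚ D 0) i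
  coeff-*ₛ-2+ D≥3 n = trans (cong (λ f → coeff f i) (*ₛ-Σₚ A D (2 + n)))
    (trans (coeff-Σₚ-suc (term (2 + n)) (2 + n) i) (cong₂ ℤ._+_
      (trans (coeff-Σₚ-suc (term (2 + n)) (1 + n) i) (cong₂ ℤ._+_
        (trans (coeff-Σₚ-suc (term (2 + n)) n i) (trans
          (cong (ℤ._+ coeff (term (2 + n) n) i) (coeff-Σₚ-zero (term (2 + n)) n i early))
          (trans (ℤ.+-identityˡ _) (at n 2 (m+n∸n≡m 2 n)))))
        (at (1 + n) 1 (m+n∸n≡m 1 n))))
      (at (2 + n) 0 (n∸n≡0 n))))
    where
    at : ∀ j d → 2 + n ∸ j ≡ d → coeff (term (2 + n) j) i ≡ coeff (A j *ₚ D d) i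
    at j d e = cong (λ d → coeff (A j *ₚ D d) i) e

    -- For `j < n` the index of `D` is at least 3; `d` is the excess over 3.
    gap : ∀ j d → suc j + d ≡ n → 2 + n ∸ j ≡ 3 + d
    gap j d refl = trans (cong (λ x → 3 + x ∸ j) (+-comm j d)) (m+n∸n≡m (3 + d) j)

    early : ∀ j → j < n → coeff (term (2 + n) j) i ≡ 0ℤ
    early j j<n with d , e ← m≤n⇒∃[o]m+o≡n j<n = trans (at j (3 + d) (gap j d e))
      (trans (cong (λ f → coeff (A j *ₚ f) i) (D≥3 d)) (coeff-*ₚ0ₚ (A j) i))

-- The tiling recurrence as an inverse power series

-- Here `x` and `y` will be the numbers of tilings with p tiles of lengths n and n+1, so that
-- `a * y + x` is the number with p+1 tiles of length n+2.
cancel₂ : ∀ a x y → + x ℤ.* -1ℤ ℤ.+ + y ℤ.* (ℤ.- (+ a)) ℤ.+ + (a * y + x) ≡ 0ℤ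
cancel₂ a x y = trans
  (cong (λ z → + x ℤ.* -1ℤ ℤ.+ + y ℤ.* (ℤ.- (+ a)) ℤ.+ z)
    (trans (ℤ.pos-+ (a * y) x) (cong (ℤ._+ + x) (ℤ.pos-* a y))))
  (solve 3 (λ a x y → x :* con -1ℤ :+ y :* (:- a) :+ (a :* y :+ x) := con 0ℤ) refl (+ a) (+ x) (+ y))

cancel₁ : ∀ a y → + y ℤ.* (ℤ.- (+ a)) ℤ.+ + (a * y) ≡ 0ℤ
cancel₁ a y = trans (cong (λ z → + y ℤ.* (ℤ.- (+ a)) ℤ.+ z) (ℤ.pos-* a y))
  (solve 2 (λ a y → y :* (:- a) :+ a :* y := con 0ℤ) refl (+ a) (+ y))

tilings-series : ∀ k → 1 ≤ k → (A : Series) → (∀ n p → coeff (A n) p ≡ + #tilings (k ∸ 1) n p) →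
  A ≈1/ (1ₛ -ₛ ((+ k - 1ℤ) ·x) ·t^ 1 -ₛ (1ℤ ·x) ·t^ 2)
tilings-series (suc a) _ A c = inverse
  where
  D : Series
  D = 1ₛ -ₛ ((+ suc a - 1ℤ) ·x) ·t^ 1 -ₛ (1ℤ ·x) ·t^ 2

  -- With `a` equal to k-1, the values `D 0`, `D 1` and `D 2` compute to `1ₚ`, `(ℤ.- (+ a)) ·x` and
  -- `-1ℤ ·x`.
  at-D₀ : ∀ n p → coeff (A n *ₚ D 0) p ≡ + #tilings a n p
  at-D₀ n p = trans (coeff-*ₚ1ₚ (A n) p) (c n p)

  at-D₁ : ∀ n p → coeff (A n *ₚ D 1) (suc p) ≡ + #tilings a n p ℤ.* (ℤ.- (+ a))
  at-D₁ n p = trans (coeff-*ₚ·x-suc (A n) (ℤ.- (+ a)) p) (cong (ℤ._* (ℤ.- (+ a))) (c n p))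

  at-D₂ : ∀ n p → coeff (A n *ₚ D 2) (suc p) ≡ + #tilings a n p ℤ.* -1ℤ
  at-D₂ n p = trans (coeff-*ₚ·x-suc (A n) -1ℤ p) (cong (ℤ._* -1ℤ) (c n p))

  inverse : A *ₛ D ≈ₛ 1ₛ
  inverse zero p = trans (coeff-*ₛ-0 A D p) (trans (at-D₀ 0 p) (constant p))
    where
    constant : ∀ p → + #tilings a 0 p ≡ coeff 1ₚ p
    constant zero    = refl
    constant (suc p) = refl
  -- Constant coefficients vanish from here on: a multiple of x has none, and a positive length
  -- cannot be tiled by zero tiles.
  inverse (suc zero) zero = trans (coeff-*ₛ-1 A D 0)
    (cong₂ ℤ._+_ (coeff-*ₚ·x-zero (A 0) (ℤ.- (+ a))) (at-D₀ 1 0))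
  inverse (suc zero) (suc p) = trans (coeff-*ₛ-1 A D (suc p)) (trans
    (cong₂ ℤ._+_ (at-D₁ 0 p) (trans (at-D₀ 1 (suc p)) (cong +_ (#tilings-1 a p))))
    (cancel₁ a (#tilings a 0 p)))
  inverse (suc (suc n)) zero = trans (coeff-*ₛ-2+ A D 0 (λ _ → refl) n)
    (cong₂ ℤ._+_ (cong₂ ℤ._+_ (coeff-*ₚ·x-zero (A n) -1ℤ) (coeff-*ₚ·x-zero (A (suc n)) (ℤ.- (+ a))))
                 (at-D₀ (2 + n) 0))
  inverse (suc (suc n)) (suc p) = trans (coeff-*ₛ-2+ A D (suc p) (λ _ → refl) n) (trans
    (cong₂ ℤ._+_ (cong₂ ℤ._+_ (at-D₂ n p) (at-D₁ (suc n) p))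
                 (trans (at-D₀ (2 + n) (suc p)) (cong +_ (#tilings-2+ a n p))))
    (cancel₂ a (#tilings a n p) (#tilings a (suc n) p)))

theorem4p11 : (k : ℕ) (2≤k : 2 ≤ k) →
    (λ n → H (M n k {{>-nonZero (<⇒≤ 2≤k)}}))
    ≈1/ (1ₛ -ₛ ((+ k - 1ℤ) ·x) ·t^ 1 -ₛ (1ℤ ·x) ·t^ 2)
theorem4p11 k 2≤k = tilings-series k (<⇒≤ 2≤k)
  (λ n → H (M n k {{>-nonZero (<⇒≤ 2≤k)}})) (coeff-H-Munarini k 2≤k)
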